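{- Let $\mathcal{H}$ be a hypergraph, and let $\mathcal{H}_1$ and $\mathcal{H}_2$ be two hypergraphs such that $\mathcal{H} \to^* \mathcal{H}_1$ and $\mathcal{H} \to^* \mathcal{H}_2$ (i.e., each is obtained from $\mathcal{H}$ by iterative application of the edge-domination and node-domination rules), and such that no rule can be applied to $\mathcal{H}_1$ or to $\mathcal{H}_2$ (i.e., for each $i \in \{1,2\}$ there is no hypergraph $\mathcal{H}'$ with $\mathcal{H}_i \to \mathcal{H}'$). Then $\mathcal{H}_1$ and $\mathcal{H}_2$ are isomorphic.
   Context: A hypergraph is a triple $\mathcal{H} = (V,E,I)$ where $V$ is a finite set (of nodes), $E$ is a finite set (of hyperedges, or edges), and $I \subseteq V \times E$ is a binary relation (the incidence relation). Distinct edges may be incident to the same set of nodes. For $v \in V$ let $E(v) = \{e \in E : (v,e) \in I\}$, and for $e \in E$ let $V(e) = \{v \in V : (v,e) \in I\}$. Edge-domination: if $e, e' \in E$ satisfy $e \neq e'$ and $V(e) \subseteq V(e')$, then the rule removes $e'$, giving $\mathcal{H}' = (V',E',I')$ with $V' = V$, $E' = E \setminus \{e'\}$, $I' = \{(v,f) \in I : f \neq e'\}$. This is written $\mathcal{H} \to_{\text{edge}} \mathcal{H}'$. Node-domination: if $v, v' \in V$ satisfy $v \neq v'$ and $E(v) \subseteq E(v')$, then the rule removes $v$, giving $\mathcal{H}' = (V',E',I')$ with $V' = V \setminus \{v\}$, $E' = E$, $I' = \{(u,e) \in I : u \neq v\}$. This is written $\mathcal{H} \to_{\text{node}} \mathcal{H}'$.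 The relation $\to$ is the union of $\to_{\text{edge}}$ and $\to_{\text{node}}$, and $\to^*$ is the reflexive and transitive closure of $\to$. Two hypergraphs $\mathcal{H} = (V,E,I)$ and $\mathcal{H}' = (V',E',I')$ are isomorphic if there exist bijections $f \colon V' \to V$ and $g \colon E' \to E$ such that for all $v \in V'$ and $e \in E'$, $(v,e) \in I'$ if and only if $(f(v),g(e)) \in I$. -}

module Defs where

open import Data.Nat.Base using (zero; suc)
open import Data.Fin.Base using (Fin; punchIn; punchOut)
open import Data.Fin.Properties using (punchInᵢ≢i; punchIn-punchOut; punchOut-cong; punchOut-punchIn)
open import Data.Irrelevant using ([_])
open import Data.Product.Base using (∃; Σ-syntax; _,_)
open import Data.Refinement using (Refinement-syntax; _,_; value)
open import Data.Refinement.Properties using (value-injective)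
open import Function.Bundles using (_↔_; _⤖_; _⇔_; mk↔ₛ′; module Inverse; module Bijection)
open import Level using (0ℓ)
open import Relation.Binary.Construct.Closure.ReflexiveTransitive using (Star)
open import Relation.Binary.Construct.Union using (_∪_)
open import Relation.Binary.Core using (REL; Rel)
open import Relation.Binary.PropositionalEquality
open import Relation.Nullary using (¬_)
open import Relation.Nullary.Recomputable using (¬-recompute)
open import Relation.Unary using (Pred; _⊆_)

Finite : Set → Set
Finite A = ∃ λ n → A ↔ Fin n

-- A ∖ {x}. The proof of inequality is irrelevant, so elements of the
-- difference are equal as soon as their values in A are.
infixl 6 _∖_
_∖_ : (A : Set) → A → Set
A ∖ x = [ y ∈ A ∣ y ≢ x ]

∖-finite : ∀ {A} → Finite A → (x : A) → Finite (A ∖ x)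
∖-finite {A} (zero  , A↔) x with () ← Inverse.to A↔ x
∖-finite {A} (suc n , A↔) x = n , mk↔ₛ′ fwd bwd fwd-bwd bwd-fwd
  where
  open Inverse A↔

  distinct : (y : A ∖ x) → to x ≢ to (value y)
  distinct (y , [ y≢x ]) eq = ¬-recompute y≢x
    (trans (sym (strictlyInverseʳ y)) (trans (cong from (sym eq)) (strictlyInverseʳ x)))

  fwd : A ∖ x → Fin n
  fwd y = punchOut (distinct y)

  bwd : Fin n → A ∖ x
  bwd i = from (punchIn (to x) i) , [ (λ eq → punchInᵢ≢i (to x) i
    (trans (sym (strictlyInverseˡ _)) (cong to eq))) ]

  fwd-bwd : ∀ i → fwd (bwd i) ≡ i
  fwd-bwd i = trans (punchOut-cong (to x) (strictlyInverseˡ _)) (punchOut-punchIn (to x))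

  bwd-fwd : ∀ y → bwd (fwd y) ≡ y
  bwd-fwd y = value-injective
    (trans (cong from (punchIn-punchOut (distinct y))) (strictlyInverseʳ (value y)))

-- The incidence relation is not required to be decidable.
record Hypergraph : Set₁ where
  field
    V        : Set
    E        : Set
    I        : REL V E 0ℓ
    V-finite : Finite V
    E-finite : Finite E

  edgesOf : V → Pred E 0ℓ
  edgesOf v e = I v e

  nodesOf : E → Pred V 0ℓ
  nodesOf e v = I v e

open Hypergraph

removeEdge : (H : Hypergraph) → E H → Hypergraph
removeEdge H e .V        = V H
removeEdge H e .E        = E H ∖ e
removeEdge H e .I v f    = I H v (value f)
removeEdge H e .V-finite = V-finite H
removeEdge H e .E-finite = ∖-finite (E-finite H) e

removeNode : (H : Hypergraph) → V H → Hypergraph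
removeNode H v .V        = V H ∖ v
removeNode H v .E        = E H
removeNode H v .I u e    = I H (value u) e
removeNode H v .V-finite = ∖-finite (V-finite H) v
removeNode H v .E-finite = E-finite H

infix 4 _→edge_ _→node_ _⟶_ _⟶*_

data _→edge_ (H : Hypergraph) : Hypergraph → Set where
  edge-domination : (e e′ : E H) → e ≢ e′ → nodesOf H e ⊆ nodesOf H e′ →
                    H →edge removeEdge H e′

-- In contrast to edges, it is the node with the smaller incidence set
-- that is removed.
data _→node_ (H : Hypergraph) : Hypergraph → Set where
  node-domination : (v v′ : V H) → v ≢ v′ → edgesOf H v ⊆ edgesOf H v′ →
                    H →node removeNode H v

_⟶_ : Rel Hypergraph 0ℓ
_⟶_ = _→edge_ ∪ _→node_

_⟶*_ : Rel Hypergraph (Level.suc 0ℓ)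
_⟶*_ = Star _⟶_

Irreducible : Hypergraph → Set₁
Irreducible H = ¬ (∃ λ H′ → H ⟶ H′)

Isomorphic : Rel Hypergraph 0ℓ
Isomorphic H H′ =
  Σ[ f ∈ (V H′ ⤖ V H) ] Σ[ g ∈ (E H′ ⤖ E H) ]
    (∀ v e → I H′ v e ⇔ I H (Bijection.to f v) (Bijection.to g e))

{-# OPTIONS --safe #-}
module Submission where

open import Defs
open import Data.Fin.Properties using (inj⇒≟)
open import Data.Irrelevant using ([_])
open import Data.Product.Base using (_×_; _,_; proj₁; proj₂)
open import Data.Refinement using (_,_; value)
open import Data.Sum.Base using (_⊎_; inj₁; inj₂)
import Data.Sum.Base as Sum
open import Function.Base using (_∘_; id)
open import Function.Bundles using (mk⇔; mk↔ₛ′)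
open import Function.Properties.Inverse using (↔⇒↣; ↔⇒⤖)
open import Level using (0ℓ)
open import Relation.Binary.Construct.Closure.ReflexiveTransitive using (Star; ε; _◅_; _◅◅_; gmap)
open import Relation.Binary.Core using (Rel)
open import Relation.Binary.Definitions using (DecidableEquality)
open import Relation.Binary.PropositionalEquality
open import Relation.Nullary using (yes; no; contradiction)
open import Relation.Unary using (_⊆_)

open Hypergraph

-- Call a pair of maps φ : V H → V K, ψ : E K → E H with
-- I H v (ψ e) → I K (φ v) e a morphism from H to K, and call two morphisms
-- homotopic if they are joined by a chain of morphisms in which only one of the
-- two components changes at a time. Each domination step is a homotopy
-- equivalence, because replacing the removed element by the one dominating it
-- is a morphism. In an irreducible hypergraph a morphism with one identity
-- component has both, so the identity is alone in its homotopy class. Hence a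
-- homotopy equivalence between irreducible hypergraphs is an isomorphism.

private
  variable
    H K L : Hypergraph

-- Finiteness enters here: decidable equality lets `replace` test for the removed element and lets
-- irreducibility yield equations.
finite⇒≟ : ∀ {A} → Finite A → DecidableEquality A
finite⇒≟ (_ , A↔Fin) = inj⇒≟ (↔⇒↣ A↔Fin)

-- Edges map backwards so that one notion fits both rules: an edge is replaced by one with a smaller
-- node set, a node by one with a larger edge set.
record Morphism (H K : Hypergraph) : Set where
  field
    onV  : V H → V K
    onE  : E K → E H
    lift : ∀ v e → I H v (onE e) → I K (onV v) e

open Morphism

identity : Morphism H H
identity .onV       = id
identity .onE       = id
identity .lift _ _ i = i

infixr 9 _⊙_
_⊙_ : Morphism K L → Morphism H K → Morphism H L
(g ⊙ f) .onV        = onV g ∘ onV f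
(g ⊙ f) .onE        = onE f ∘ onE g
(g ⊙ f) .lift v e i = lift g _ e (lift f v _ i)

infix 4 _∼_ _≃_ _≋_

_∼_ : Rel (Morphism H K) 0ℓ
f ∼ g = onV f ≗ onV g ⊎ onE f ≗ onE g

_≃_ : Rel (Morphism H K) 0ℓ
_≃_ = Star _∼_

⊙-congˡ : (g : Morphism K L) {f f′ : Morphism H K} → f ≃ f′ → g ⊙ f ≃ g ⊙ f′
⊙-congˡ g = gmap (g ⊙_) (Sum.map (λ p v → cong (onV g) (p v)) (λ p e → p (onE g e)))

⊙-congʳ : (f : Morphism H K) {g g′ : Morphism K L} → g ≃ g′ → g ⊙ f ≃ g′ ⊙ f
⊙-congʳ f = gmap (_⊙ f) (Sum.map (λ p v → p (onV f v)) (λ p e → cong (onE f) (p e)))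

record _≋_ (H K : Hypergraph) : Set where
  field
    to   : Morphism H K
    from : Morphism K H
    unit   : identity ≃ from ⊙ to
    counit : identity ≃ to ⊙ from

open _≋_

≋-refl : H ≋ H
≋-refl .to     = identity
≋-refl .from   = identity
≋-refl .unit   = ε
≋-refl .counit = ε

≋-sym : H ≋ K → K ≋ H
≋-sym p .to     = from p
≋-sym p .from   = to p
≋-sym p .unit   = counit p
≋-sym p .counit = unit p

≋-trans : H ≋ K → K ≋ L → H ≋ L
≋-trans p q .to     = to q ⊙ to p
≋-trans p q .from   = from p ⊙ from q
≋-trans p q .unit   = unit p ◅◅ ⊙-congˡ (from p) (⊙-congʳ (to p) (unit q))
≋-trans p q .counit = counit q ◅◅ ⊙-congˡ (to q) (⊙-congʳ (from q) (counit p))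

replace : ∀ {A} → DecidableEquality A → {x y : A} → y ≢ x → A → A ∖ x
replace _≟_ {x} {y} y≢x z with z ≟ x
... | yes _  = y , [ y≢x ]
... | no z≢x = z , [ z≢x ]

edge⇒≋ : H →edge K → H ≋ K
edge⇒≋ {H} (edge-domination e e′ e≢e′ e⊆e′) = λ where
    .to .onV          → id
    .to .onE          → value
    .to .lift _ _ i   → i
    .from .onV        → id
    .from .onE        → replace _≟_ e≢e′
    .from .lift _ f i → below f i
    -- Both round trips are the identity on nodes, so one step suffices, whatever they do to edges.
    .unit             → inj₁ (λ _ → refl) ◅ ε
    .counit           → inj₁ (λ _ → refl) ◅ ε
  where
  _≟_ = finite⇒≟ (E-finite H)

  below : ∀ f → nodesOf H (value (replace _≟_ e≢e′ f)) ⊆ nodesOf H f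
  below f i with f ≟ e′
  ... | yes refl = e⊆e′ i
  ... | no _     = i

node⇒≋ : H →node K → H ≋ K
node⇒≋ {H} (node-domination v v′ v≢v′ v⊆v′) = λ where
    -- Nodes map forwards, so the replacement sits in `to`; for edges it sits in `from`.
    .to .onV          → replace _≟_ (≢-sym v≢v′)
    .to .onE          → id
    .to .lift u _ i   → above u i
    .from .onV        → value
    .from .onE        → id
    .from .lift _ _ i → i
    .unit             → inj₂ (λ _ → refl) ◅ ε
    .counit           → inj₂ (λ _ → refl) ◅ ε
  where
  _≟_ = finite⇒≟ (V-finite H)

  above : ∀ u → edgesOf H u ⊆ edgesOf H (value (replace _≟_ (≢-sym v≢v′) u))
  above u i with u ≟ v
  ... | yes refl = v⊆v′ i
  ... | no _     = i

⟶*⇒≋ : H ⟶* K → H ≋ K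
⟶*⇒≋ ε             = ≋-refl
⟶*⇒≋ (inj₁ s ◅ ss) = ≋-trans (edge⇒≋ s) (⟶*⇒≋ ss)
⟶*⇒≋ (inj₂ s ◅ ss) = ≋-trans (node⇒≋ s) (⟶*⇒≋ ss)

module _ (irr : Irreducible H) where

  edge-minimal : ∀ e e′ → nodesOf H e ⊆ nodesOf H e′ → e ≡ e′
  edge-minimal e e′ e⊆e′ with finite⇒≟ (E-finite H) e e′
  ... | yes e≡e′ = e≡e′
  ... | no e≢e′  = contradiction (_ , inj₁ (edge-domination e e′ e≢e′ e⊆e′)) irr

  node-maximal : ∀ v v′ → edgesOf H v ⊆ edgesOf H v′ → v ≡ v′
  node-maximal v v′ v⊆v′ with finite⇒≟ (V-finite H) v v′
  ... | yes v≡v′ = v≡v′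
  ... | no v≢v′  = contradiction (_ , inj₂ (node-domination v v′ v≢v′ v⊆v′)) irr

  -- Once nodes are fixed, `lift` says exactly that the nodes of `onE f e` lie in `e`, and
  -- irreducibility rules out a proper domination.
  onV-id⇒onE-id : (f : Morphism H H) → onV f ≗ id → onE f ≗ id
  onV-id⇒onE-id f p e = edge-minimal (onE f e) e
    λ {v} i → subst (λ u → I H u e) (p v) (lift f v e i)

  onE-id⇒onV-id : (f : Morphism H H) → onE f ≗ id → onV f ≗ id
  onE-id⇒onV-id f q v = sym (node-maximal v (onV f v)
    λ {e} i → lift f v e (subst (I H v) (sym (q e)) i))

  -- Both components are carried along the chain because each step may preserve either one; the
  -- preserved one stays the identity and forces the other.
  rigid : {f g : Morphism H H} → f ≃ g →
          onV f ≗ id × onE f ≗ id → onV g ≗ id × onE g ≗ id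
  rigid ε                  f≗id    = f≗id
  rigid (_◅_ {j = h} s ss) (p , q) = rigid ss (step s)
    where
    step : _ → onV h ≗ id × onE h ≗ id
    step (inj₁ r) = let p′ = λ v → trans (sym (r v)) (p v) in p′ , onV-id⇒onE-id h p′
    step (inj₂ r) = let q′ = λ e → trans (sym (r e)) (q e) in onE-id⇒onV-id h q′ , q′

  ≃-identity : {f : Morphism H H} → identity ≃ f → onV f ≗ id × onE f ≗ id
  ≃-identity id≃f = rigid id≃f ((λ _ → refl) , (λ _ → refl))

≋⇒Isomorphic : Irreducible H → Irreducible K → H ≋ K → Isomorphic H K
≋⇒Isomorphic {H} {K} irrH irrK p =
  -- The bijections must run from `K` to `H`, so nodes use `from` and the contravariant edges use
  -- `to`.
  ↔⇒⤖ (mk↔ₛ′ (onV (from p)) (onV (to p)) (proj₁ from∘to) (proj₁ to∘from)) ,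
  ↔⇒⤖ (mk↔ₛ′ (onE (to p)) (onE (from p)) (proj₂ from∘to) (proj₂ to∘from)) ,
  λ v e → mk⇔
    -- Each direction of the equivalence is one `lift`, corrected by a round trip on `K` that is the
    -- identity.
    (λ i → lift (from p) v (onE (to p) e) (subst (I K v) (sym (proj₂ to∘from e)) i))
    (λ i → subst (λ u → I K u e) (proj₁ to∘from v) (lift (to p) (onV (from p) v) e i))
  where
  from∘to = ≃-identity irrH (unit p)
  to∘from = ≃-identity irrK (counit p)

corollary1p2 : (H H₁ H₂ : Hypergraph) → H ⟶* H₁ → H ⟶* H₂ →
    Irreducible H₁ → Irreducible H₂ → Isomorphic H₁ H₂
corollary1p2 H H₁ H₂ H⟶*H₁ H⟶*H₂ irr₁ irr₂ =
  ≋⇒Isomorphic irr₁ irr₂ (≋-trans (≋-sym (⟶*⇒≋ H⟶*H₁)) (⟶*⇒≋ H⟶*H₂))
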